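{- Let $k\ge 1$ and $1\le k^*\le k$ be integers. For $r\in\{1,2\}$, run the Reduce-By-Median-Counter algorithm (defined in the context) with parameters $k,k^*$ on a weighted stream $\sigma_r$ of weighted length $N_r$, producing summary $S_r$. Let $\sigma=\sigma_1\circ\sigma_2$ be the concatenated stream, $N=N_1+N_2$, and $f_i$ the frequency of item $i$ in $\sigma$. Apply the merge procedure: for each item $i$ assigned a counter $c_2(i)$ in $S_2$ (in any order), call Update$(i,c_2(i))$ on $S_1$. Let $C$ be the sum of the counter values of the resulting summary and $\hat f_i$ its output of Estimate$(i)$. Then for every $i\in[m]$, $$0\le f_i-\hat f_i\le\frac{N-C}{k^*},$$ and moreover for every integer $0\le j<k^*$, $$0\le f_i-\hat f_i\le\frac{N^{\mathrm{res}(j)}}{k^*-j},$$ where $N^{\mathrm{res}(j)}$ is computed for $\sigma$.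
   Context: A weighted stream over the universe $[m]=\{1,\dots,m\}$ is a sequence of updates $(i_t,\Delta_t)$ with $i_t\in[m]$ and real weights $\Delta_t>0$; its weighted length is $\sum_t\Delta_t$. The frequency of $i$ in a stream is the sum of $\Delta_t$ over updates with $i_t=i$. $N^{\mathrm{res}(j)}$ denotes the sum of the frequencies of all items except the $j$ items of largest frequency (ties broken arbitrarily). The Reduce-By-Median-Counter algorithm with integer parameters $k\ge 1$ and $1\le k^*\le k$ maintains a set $T\subseteq[m]$ of at most $k$ items, each $j\in T$ carrying a nonnegative real counter $c(j)$; initially $T=\emptyset$. Update$(i,\Delta)$: if $i\in T$, set $c(i)\gets c(i)+\Delta$; else if $|T|<k$, add $i$ to $T$ with $c(i)=\Delta$; else call DecrementCounters(), and afterwards, if $\Delta\ge c_{k^*}$, add $i$ to $T$ with $c(i)=\Delta-c_{k^*}$. DecrementCounters(): let $c_{k^*}$ be the $k^*$-th largest value, counting multiplicity, of the multiset $\{c(j): j\in T\}$; for every $j\in T$ set $c(j)\gets c(j)-c_{k^*}$, and remove $j$ from $T$ if now $c(j)\le 0$. Estimate$(i)$ returns $c(i)$ if $i\in T$ and $0$ otherwise. -}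

module Defs where

open import Algebra.Bundles using (CommutativeRing)
open import Data.Bool.Base using (if_then_else_)
open import Data.Fin.Base using (Fin)
import Data.Fin.Properties as Fin
open import Data.List.Base using (List; allFin; drop; filter; foldl; foldr; head; length; map; mapMaybe; tabulate)
import Data.List.Sort as Sort
open import Data.Maybe.Base as Maybe using (Maybe; just; nothing; fromMaybe)
open import Data.Nat.Base as ℕ using (ℕ)
import Data.Nat.Properties as ℕ
open import Data.Product.Base using (_×_; _,_; proj₁; proj₂)
open import Data.Vec.Functional using (updateAt)
open import Function.Base using (const)
open import Level using (Level; _⊔_; suc)
open import Relation.Binary.Bundles using (DecTotalOrder)
open import Relation.Binary.Core using (Rel)
import Relation.Binary.Construct.NonStrictToStrict as ToStrict
import Relation.Binary.Properties.DecTotalOrder as DecTotalOrderProperties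
open import Relation.Binary.Structures using (IsDecTotalOrder)
open import Relation.Nullary.Decidable.Core using (does; yes; no)
open import Relation.Nullary.Negation.Core using (¬_)

import Algebra.Definitions.RawMonoid as RawMonoidDefinitions

-- Linearly ordered fields with decidable order. The library has no real
-- numbers; classically ℝ is an instance. The inverse is a total function
-- that is unconstrained at 0#.
record OrderedField (c ℓ₁ ℓ₂ : Level) : Set (suc (c ⊔ ℓ₁ ⊔ ℓ₂)) where
  field
    commutativeRing : CommutativeRing c ℓ₁

  open CommutativeRing commutativeRing public

  infix 4 _≤_
  infix 8 _⁻¹

  field
    _≤_             : Rel Carrier ℓ₂
    isDecTotalOrder : IsDecTotalOrder _≈_ _≤_
    +-monoˡ-≤       : ∀ z {x y} → x ≤ y → x + z ≤ y + z
    *-nonNegative   : ∀ {x y} → 0# ≤ x → 0# ≤ y → 0# ≤ x * y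
    0#≉1#           : ¬ (0# ≈ 1#)
    _⁻¹             : Carrier → Carrier
    ⁻¹-cong         : ∀ {x y} → x ≈ y → x ⁻¹ ≈ y ⁻¹
    ⁻¹-inverseʳ     : ∀ x → ¬ (x ≈ 0#) → x * x ⁻¹ ≈ 1#

  decTotalOrder : DecTotalOrder c ℓ₁ ℓ₂
  decTotalOrder = record { isDecTotalOrder = isDecTotalOrder }

  open IsDecTotalOrder isDecTotalOrder public using (_≤?_)
  open ToStrict _≈_ _≤_ public using (_<_)

  infixl 7 _/_

  _/_ : Carrier → Carrier → Carrier
  x / y = x * y ⁻¹

  fromℕ : ℕ → Carrier
  fromℕ n = n ×ᴹ 1#
    where open RawMonoidDefinitions +-rawMonoid renaming (_×_ to _×ᴹ_)

  sum : List Carrier → Carrier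
  sum = foldr _+_ 0#

  sortDescending : List Carrier → List Carrier
  sortDescending = Sort.sort (DecTotalOrderProperties.≥-decTotalOrder decTotalOrder)

module Streams {c ℓ₁ ℓ₂ : Level} (F : OrderedField c ℓ₁ ℓ₂) (m : ℕ) where

  open OrderedField F

  Item : Set
  Item = Fin m

  -- Positivity of the weights is not part of the type.
  Stream : Set c
  Stream = List (Item × Carrier)

  weightedLength : Stream → Carrier
  weightedLength σ = sum (map proj₂ σ)

  frequency : Stream → Item → Carrier
  frequency σ i = sum (map proj₂ (filter (λ u → proj₁ u Fin.≟ i) σ))

  -- N^res(j)
  residual : Stream → ℕ → Carrier
  residual σ j = sum (drop j (sortDescending (tabulate (frequency σ))))

module ReduceByMedian
  {c ℓ₁ ℓ₂ : Level} (F : OrderedField c ℓ₁ ℓ₂) (m k k* : ℕ) where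

  open OrderedField F
  open Streams F m

  -- T is the set of items mapped to a just. That T has at most k elements
  -- is an invariant of update, not part of the type.
  Summary : Set c
  Summary = Item → Maybe Carrier

  empty : Summary
  empty _ = nothing

  entries : Summary → List (Item × Carrier)
  entries S = mapMaybe (λ i → Maybe.map (i ,_) (S i)) (allFin m)

  counters : Summary → List Carrier
  counters S = map proj₂ (entries S)

  size : Summary → ℕ
  size S = length (entries S)

  set : Summary → Item → Carrier → Summary
  set S i x = updateAt S i (const (just x))

  -- The k*-th largest counter. The default 0# is never reached when
  -- 1 ≤ k* ≤ k ≤ size S, and update uses it only when k ≤ size S.
  threshold : Summary → Carrier
  threshold S = fromMaybe 0# (head (drop (k* ℕ.∸ 1) (sortDescending (counters S))))

  decrementCounters : Summary → Summary
  decrementCounters S j = S j Maybe.>>= λ x →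
    if does (x - threshold S ≤? 0#) then nothing else just (x - threshold S)

  update : Summary → Item × Carrier → Summary
  update S (i , Δ) with S i | size S ℕ.<? k | threshold S ≤? Δ
  ... | just x  | _     | _     = set S i (x + Δ)
  ... | nothing | yes _ | _     = set S i Δ
  ... | nothing | no _  | yes _ = set (decrementCounters S) i (Δ - threshold S)
  ... | nothing | no _  | no _  = decrementCounters S

  run : Stream → Summary
  run = foldl update empty

  estimate : Summary → Item → Carrier
  estimate S i = fromMaybe 0# (S i)

  -- The second argument lists the entries of the summary merged in, in the
  -- order in which they are processed.
  merge : Summary → List (Item × Carrier) → Summary
  merge = foldl update

  counterSum : Summary → Carrier
  counterSum S = sum (counters S)

{-# OPTIONS --safe #-}

-- The errors eⱼ = fⱼ − f̂ⱼ always satisfy 0 ≤ eⱼ ≤ D and k* D ≤ Σ eⱼ for some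
-- D. A decrement by d lowers every counter c by min(c, d) ≤ d, and it lowers
-- the k* largest ones by exactly d, so the property survives each update with
-- D increased by d. It is also additive in e, and the error of the merged
-- summary is the sum of the errors of the two runs and of the error made while
-- feeding the second summary to the first. Since Σ eⱼ = N − C, this is the
-- first bound. For the second, eⱼ ≤ min(fⱼ, D) gives k* D ≤ j D + N^res(j).
module Submission where

open import Data.Bool.Base using (if_then_else_)
open import Data.Fin.Base using (Fin; zero; suc)
import Data.Fin.Properties as Fin
open import Data.List.Base using (List; []; _∷_; _++_; allFin; drop; foldl; head; length; map; mapMaybe; tabulate)
open import Data.List.Properties using (length-map; map-++; map-tabulate; map-∘)
open import Data.List.Relation.Binary.Permutation.Propositional as Perm using (_↭_; ↭-sym)
open import Data.List.Relation.Binary.Permutation.Propositional.Properties using (All-resp-↭; filter-↭; map⁺; ↭-length)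
import Data.List.Sort as Sort
open import Data.List.Relation.Unary.All as All using (All; []; _∷_)
import Data.List.Relation.Unary.All.Properties as All
open import Data.List.Relation.Unary.AllPairs using (AllPairs; _∷_)
open import Data.List.Relation.Unary.Linked.Properties using (Linked⇒AllPairs)
open import Data.Maybe.Base as Maybe using (just; nothing; fromMaybe; maybe′)
import Data.Maybe.Relation.Unary.All as Maybe using (All; just; nothing)
open import Data.Nat.Base as ℕ using (ℕ; zero; suc; s≤s)
import Data.Nat.Properties as ℕ
open import Data.Product.Base using (_×_; _,_; proj₁; proj₂)
open import Data.Sum.Base using (inj₁; inj₂)
open import Data.Vec.Functional.Properties using (updateAt-updates; updateAt-minimal)
open import Function.Base using (_∘_; id)
open import Level using (Level; _⊔_)
open import Relation.Binary.Bundles using (DecTotalOrder)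
import Relation.Binary.Properties.DecTotalOrder as DecTotalOrderProperties
import Relation.Binary.PropositionalEquality.Core as ≡
open import Relation.Nullary.Decidable.Core using (does; yes; no)
open import Relation.Nullary.Negation.Core using (¬_; contradiction)
open ≡ using (_≡_)
open import Defs

-- Arithmetic and order in an ordered field.

module OrderedFieldProperties {c ℓ₁ ℓ₂ : Level} (F : OrderedField c ℓ₁ ℓ₂) where

  open OrderedField F hiding (zero)
  open DecTotalOrder decTotalOrder public
    using (totalOrder; poset; total; antisym)
    renaming (refl to ≤-refl; reflexive to ≤-reflexive; trans to ≤-trans)
  open DecTotalOrderProperties decTotalOrder public using (≰⇒≥; ≥-decTotalOrder)
  open import Algebra.Construct.NaturalChoice.Min totalOrder public
  open import Algebra.Properties.CommutativeMonoid.Sum +-commutativeMonoid public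
    using (∑-distrib-+; sum-cong-≋; sum-replicate-zero)
    renaming (sum to ∑)
  open import Algebra.Properties.Semiring.Mult semiring public
    using (×-homo-+; ×-congʳ; ×-assoc-*)
    renaming (_×_ to _·_)
  open import Algebra.Properties.CommutativeMonoid.Mult +-commutativeMonoid public
    using (×-distrib-+)
  open import Algebra.Properties.Ring ring using (-‿distribʳ-*; -‿involutive)
  open import Algebra.Properties.CommutativeSemigroup +-commutativeSemigroup public
    using (interchange; x∙yz≈y∙xz; xy∙z≈xz∙y)
  open import Relation.Binary.Reasoning.PartialOrder poset

  +-mono-≤ : ∀ {x y u v} → x ≤ y → u ≤ v → x + u ≤ y + v
  +-mono-≤ {x} {y} {u} {v} x≤y u≤v = begin
    x + u ≤⟨ +-monoˡ-≤ u x≤y ⟩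
    y + u ≈⟨ +-comm y u ⟩
    u + y ≤⟨ +-monoˡ-≤ y u≤v ⟩
    v + y ≈⟨ +-comm v y ⟩
    y + v ∎

  +-nonNegative : ∀ {x y} → 0# ≤ x → 0# ≤ y → 0# ≤ x + y
  +-nonNegative {x} {y} 0≤x 0≤y = begin
    0#      ≈⟨ +-identityˡ 0# ⟨
    0# + 0# ≤⟨ +-mono-≤ 0≤x 0≤y ⟩
    x + y   ∎

  x≤x+y : ∀ x {y} → 0# ≤ y → x ≤ x + y
  x≤x+y x {y} 0≤y = begin
    x      ≈⟨ +-identityʳ x ⟨
    x + 0# ≤⟨ +-mono-≤ ≤-refl 0≤y ⟩
    x + y  ∎

  x≤y+x : ∀ {y} x → 0# ≤ y → x ≤ y + x
  x≤y+x {y} x 0≤y = ≤-trans (x≤x+y x 0≤y) (≤-reflexive (+-comm x y))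

  [x-y]+y≈x : ∀ x y → (x - y) + y ≈ x
  [x-y]+y≈x x y = trans (+-assoc x (- y) y) (trans (+-congˡ (-‿inverseˡ y)) (+-identityʳ x))

  [x+y]-x≈y : ∀ x y → (x + y) - x ≈ y
  [x+y]-x≈y x y = trans (+-congʳ (+-comm x y))
    (trans (+-assoc y x (- x)) (trans (+-congˡ (-‿inverseʳ x)) (+-identityʳ y)))

  x≈y+z⇒x-y≈z : ∀ {x y z} → x ≈ y + z → x - y ≈ z
  x≈y+z⇒x-y≈z x≈y+z = trans (+-congʳ x≈y+z) ([x+y]-x≈y _ _)

  +-cancelˡ-≤ : ∀ x {y z} → x + y ≤ x + z → y ≤ z
  +-cancelˡ-≤ x {y} {z} x+y≤x+z = begin
    y           ≈⟨ [x+y]-x≈y x y ⟨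
    (x + y) - x ≤⟨ +-monoˡ-≤ (- x) x+y≤x+z ⟩
    (x + z) - x ≈⟨ [x+y]-x≈y x z ⟩
    z           ∎

  x≤y⇒0≤y-x : ∀ {x y} → x ≤ y → 0# ≤ y - x
  x≤y⇒0≤y-x {x} {y} x≤y = begin
    0#    ≈⟨ -‿inverseʳ x ⟨
    x - x ≤⟨ +-monoˡ-≤ (- x) x≤y ⟩
    y - x ∎

  0≤y-x⇒x≤y : ∀ {x y} → 0# ≤ y - x → x ≤ y
  0≤y-x⇒x≤y {x} {y} 0≤y-x = begin
    x           ≤⟨ x≤y+x x 0≤y-x ⟩
    (y - x) + x ≈⟨ [x-y]+y≈x y x ⟩
    y           ∎

  x-y≤0⇒x≤y : ∀ {x y} → x - y ≤ 0# → x ≤ y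
  x-y≤0⇒x≤y {x} {y} x-y≤0 = begin
    x           ≈⟨ [x-y]+y≈x x y ⟨
    (x - y) + y ≤⟨ +-monoˡ-≤ y x-y≤0 ⟩
    0# + y      ≈⟨ +-identityˡ y ⟩
    y           ∎

  x≤0⇒0≤-x : ∀ {x} → x ≤ 0# → 0# ≤ - x
  x≤0⇒0≤-x {x} x≤0 = ≤-trans (x≤y⇒0≤y-x x≤0) (≤-reflexive (+-identityˡ (- x)))

  0≤-x⇒x≤0 : ∀ {x} → 0# ≤ - x → x ≤ 0#
  0≤-x⇒x≤0 {x} 0≤-x = 0≤y-x⇒x≤y (≤-trans 0≤-x (≤-reflexive (sym (+-identityˡ (- x)))))

  0≤1 : 0# ≤ 1#
  0≤1 with total 0# 1#
  ... | inj₁ 0≤1 = 0≤1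
  ... | inj₂ 1≤0 = begin
    0#            ≤⟨ *-nonNegative (x≤0⇒0≤-x 1≤0) (x≤0⇒0≤-x 1≤0) ⟩
    - 1# * - 1#   ≈⟨ -‿distribʳ-* (- 1#) 1# ⟨
    - (- 1# * 1#) ≈⟨ -‿cong (*-identityʳ (- 1#)) ⟩
    - - 1#        ≈⟨ -‿involutive 1# ⟩
    1#            ∎

  1≰0 : ¬ (1# ≤ 0#)
  1≰0 1≤0 = 0#≉1# (antisym 0≤1 1≤0)

  ·-nonNegative : ∀ n {x} → 0# ≤ x → 0# ≤ n · x
  ·-nonNegative zero    0≤x = ≤-refl
  ·-nonNegative (suc n) 0≤x = +-nonNegative 0≤x (·-nonNegative n 0≤x)

  fromℕ-suc≉0 : ∀ n → ¬ (fromℕ (suc n) ≈ 0#)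
  fromℕ-suc≉0 n 1+n≈0 = 1≰0 (≤-trans (x≤x+y 1# (·-nonNegative n 0≤1)) (≤-reflexive 1+n≈0))

  -- If the inverse were nonpositive, the product of `x` and `- (x ⁻¹)` would be nonnegative; but
  -- that product is `- 1#`.
  ⁻¹-nonNegative : ∀ {x} → 0# ≤ x → ¬ (x ≈ 0#) → 0# ≤ x ⁻¹
  ⁻¹-nonNegative {x} 0≤x x≉0 with total 0# (x ⁻¹)
  ... | inj₁ 0≤x⁻¹ = 0≤x⁻¹
  ... | inj₂ x⁻¹≤0 = contradiction (0≤-x⇒x≤0 (begin
    0#           ≤⟨ *-nonNegative 0≤x (x≤0⇒0≤-x x⁻¹≤0) ⟩
    x * - (x ⁻¹) ≈⟨ -‿distribʳ-* x (x ⁻¹) ⟨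
    - (x * x ⁻¹) ≈⟨ -‿cong (⁻¹-inverseʳ x x≉0) ⟩
    - 1#         ∎)) 1≰0

  *-monoʳ-≤ : ∀ {x y z} → 0# ≤ z → x ≤ y → x * z ≤ y * z
  *-monoʳ-≤ {x} {y} {z} 0≤z x≤y = begin
    x * z               ≤⟨ x≤y+x (x * z) (*-nonNegative (x≤y⇒0≤y-x x≤y) 0≤z) ⟩
    (y - x) * z + x * z ≈⟨ distribʳ z (y - x) x ⟨
    ((y - x) + x) * z   ≈⟨ *-congʳ ([x-y]+y≈x y x) ⟩
    y * z               ∎

  -- Estimates are kept in the form of multiples `n · x` throughout; division enters only here, to
  -- reach the form of the theorem.
  n·x≤y⇒x≤y/n : ∀ n {x y} → suc n · x ≤ y → x ≤ y / fromℕ (suc n)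
  n·x≤y⇒x≤y/n n {x} {y} n·x≤y = begin
    x               ≈⟨ *-identityʳ x ⟨
    x * 1#          ≈⟨ *-congˡ (⁻¹-inverseʳ a a≉0) ⟨
    x * (a * a ⁻¹)  ≈⟨ *-assoc x a (a ⁻¹) ⟨
    (x * a) * a ⁻¹  ≈⟨ *-congʳ (*-comm x a) ⟩
    (a * x) * a ⁻¹  ≈⟨ *-congʳ (trans (×-assoc-* (suc n) 1# x) (×-congʳ (suc n) (*-identityˡ x))) ⟩
    (suc n · x) / a ≤⟨ *-monoʳ-≤ (⁻¹-nonNegative (·-nonNegative (suc n) 0≤1) a≉0) n·x≤y ⟩
    y / a           ∎
    where
    a   = fromℕ (suc n)
    a≉0 = fromℕ-suc≉0 n

  -- Finite sums, truncated sums and order statistics.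

  sum-++ : ∀ xs ys → sum (xs ++ ys) ≈ sum xs + sum ys
  sum-++ []       ys = sym (+-identityˡ (sum ys))
  sum-++ (x ∷ xs) ys = trans (+-congˡ (sum-++ xs ys)) (sym (+-assoc x (sum xs) (sum ys)))

  sum-↭ : ∀ {xs ys} → xs ↭ ys → sum xs ≈ sum ys
  sum-↭ Perm.refl          = refl
  sum-↭ (Perm.prep x p)    = +-congˡ (sum-↭ p)
  sum-↭ (Perm.swap x y p)  = trans (+-congˡ (+-congˡ (sum-↭ p))) (x∙yz≈y∙xz x y _)
  sum-↭ (Perm.trans p q)   = trans (sum-↭ p) (sum-↭ q)

  sum-tabulate : ∀ {n} (g : Fin n → Carrier) → sum (tabulate g) ≈ ∑ g
  sum-tabulate {zero}  g = refl
  sum-tabulate {suc n} g = +-congˡ (sum-tabulate (g ∘ suc))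

  
  ∑-mono-≤ : ∀ {n} {f g : Fin n → Carrier} → (∀ i → f i ≤ g i) → ∑ f ≤ ∑ g
  ∑-mono-≤ {zero}  f≤g = ≤-refl
  ∑-mono-≤ {suc n} f≤g = +-mono-≤ (f≤g zero) (∑-mono-≤ (f≤g ∘ suc))

  sum-⊓-nonNegative : ∀ {d xs} → 0# ≤ d → All (0# ≤_) xs → 0# ≤ sum (map (_⊓ d) xs)
  sum-⊓-nonNegative 0≤d []           = ≤-refl
  sum-⊓-nonNegative 0≤d (0≤x ∷ 0≤xs) =
    +-nonNegative (⊓-glb 0≤x 0≤d) (sum-⊓-nonNegative 0≤d 0≤xs)

  -- Each of the first `j` truncated terms is at most `d`, and each later one is at most the term
  -- itself. For frequencies sorted in descending order, the last summand is the residual.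
  sum-⊓≤j·d+sum-drop : ∀ {d} → 0# ≤ d → ∀ j xs → sum (map (_⊓ d) xs) ≤ j · d + sum (drop j xs)
  sum-⊓≤j·d+sum-drop {d} 0≤d zero xs = ≤-trans (go xs) (≤-reflexive (sym (+-identityˡ (sum xs))))
    where
    go : ∀ xs → sum (map (_⊓ d) xs) ≤ sum xs
    go []       = ≤-refl
    go (x ∷ xs) = +-mono-≤ (x⊓y≤x x d) (go xs)
  -- When the list has run out before `j` terms, the surplus copies of `d` only help, as `d` is
  -- nonnegative.
  sum-⊓≤j·d+sum-drop {d} 0≤d (suc j) [] =
    +-nonNegative (·-nonNegative (suc j) 0≤d) ≤-refl
  sum-⊓≤j·d+sum-drop {d} 0≤d (suc j) (x ∷ xs) = begin
    x ⊓ d + sum (map (_⊓ d) xs)    ≤⟨ +-mono-≤ (x⊓y≤y x d) (sum-⊓≤j·d+sum-drop 0≤d j xs) ⟩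
    d + (j · d + sum (drop j xs))  ≈⟨ +-assoc d (j · d) (sum (drop j xs)) ⟨
    suc j · d + sum (drop j xs)    ∎

  -- Counts from zero and has the default of `threshold`, so that for k* = `suc n` the threshold
  -- unfolds to `nth n` of the sorted counters.
  nth : ℕ → List Carrier → Carrier
  nth n xs = fromMaybe 0# (head (drop n xs))

  nth-All : ∀ {p} {P : Carrier → Set p} n {xs} → All P xs → n ℕ.< length xs → P (nth n xs)
  nth-All zero    (px ∷ _)   _         = px
  nth-All (suc n) (_  ∷ pxs) (s≤s n<l) = nth-All n pxs n<l

  -- In a descending list the first `suc n` terms are at least `nth n xs`, so truncation at that
  -- value makes each of them equal to it; the remaining terms stay nonnegative.
  [1+n]·nth≤sum-⊓ : ∀ n {xs} → AllPairs (λ x y → y ≤ x) xs → All (0# ≤_) xs → n ℕ.< length xs →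
                    suc n · nth n xs ≤ sum (map (_⊓ nth n xs) xs)
  [1+n]·nth≤sum-⊓ zero {x ∷ xs} _ (0≤x ∷ 0≤xs) _ =
    +-mono-≤ (≤-reflexive (sym (⊓-idem x))) (sum-⊓-nonNegative 0≤x 0≤xs)
  [1+n]·nth≤sum-⊓ (suc n) {x ∷ xs} (xs≤x ∷ ps) (_ ∷ 0≤xs) (s≤s n<l) =
    +-mono-≤ (≤-reflexive (sym (x≤y⇒y⊓x≈x (nth-All n xs≤x n<l)))) ([1+n]·nth≤sum-⊓ n ps 0≤xs n<l)

  sortDescending-↭ : ∀ xs → sortDescending xs ↭ xs
  sortDescending-↭ = Sort.sort-↭ ≥-decTotalOrder

  sortDescending-AllPairs : ∀ xs → AllPairs (λ x y → y ≤ x) (sortDescending xs)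
  sortDescending-AllPairs xs =
    Linked⇒AllPairs (λ y≤x z≤y → ≤-trans z≤y y≤x) (Sort.sort-↗ ≥-decTotalOrder xs)

-- Frequency vectors as sums of point masses.

module StreamProperties {c ℓ₁ ℓ₂ : Level} (F : OrderedField c ℓ₁ ℓ₂) (m : ℕ) where

  open OrderedField F hiding (zero)
  open OrderedFieldProperties F
  open Streams F m

  -- The frequency vector of a single update. The size `n` is arbitrary to allow induction on it,
  -- and through `does` the comparison of two successors computes to that of their predecessors.
  point : ∀ {n} → Fin n × Carrier → Fin n → Carrier
  point (i , x) j = if does (i Fin.≟ j) then x else 0#

  point-+ : ∀ {n} (i : Fin n) x y j → point (i , x) j + point (i , y) j ≈ point (i , x + y) j
  point-+ i x y j with i Fin.≟ j
  ... | yes _ = refl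
  ... | no  _ = +-identityˡ 0#

  point-cong : ∀ {n} (i : Fin n) {x y} j → x ≈ y → point (i , x) j ≈ point (i , y) j
  point-cong i j x≈y with i Fin.≟ j
  ... | yes _ = x≈y
  ... | no  _ = refl

  point-nonNegative : ∀ {n} (i : Fin n) {x} j → 0# ≤ x → 0# ≤ point (i , x) j
  point-nonNegative i j 0≤x with i Fin.≟ j
  ... | yes _ = 0≤x
  ... | no  _ = ≤-refl

  ∑-point : ∀ {n} (i : Fin n) x → ∑ (point (i , x)) ≈ x
  ∑-point {suc n} zero    x = trans (+-congˡ (sum-replicate-zero n)) (+-identityʳ x)
  ∑-point         (suc i) x = trans (+-identityˡ _) (∑-point i x)

  -- Here the sum runs over the position of the mass, with the coordinate `j` fixed. This evaluates
  -- the frequencies of a stream that lists the values of a vector.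
  ∑-point-diagonal : ∀ {n} (g : Fin n → Carrier) j → ∑ (λ i → point (i , g i) j) ≈ g j
  ∑-point-diagonal {suc n} g zero    = trans (+-congˡ (sum-replicate-zero n)) (+-identityʳ (g zero))
  ∑-point-diagonal         g (suc j) = trans (+-identityˡ _) (∑-point-diagonal (g ∘ suc) j)

  frequency-∷ : ∀ u σ j → frequency (u ∷ σ) j ≈ point u j + frequency σ j
  frequency-∷ (i , x) σ j with i Fin.≟ j
  ... | yes _ = refl
  ... | no  _ = sym (+-identityˡ (frequency σ j))

  frequency-++ : ∀ σ τ j → frequency (σ ++ τ) j ≈ frequency σ j + frequency τ j
  frequency-++ []      τ j = sym (+-identityˡ (frequency τ j))
  frequency-++ (u ∷ σ) τ j = trans (frequency-∷ u (σ ++ τ) j)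
    (trans (+-congˡ (frequency-++ σ τ j))
    (trans (sym (+-assoc (point u j) (frequency σ j) (frequency τ j)))
           (+-congʳ (sym (frequency-∷ u σ j)))))

  frequency-↭ : ∀ {σ τ} → σ ↭ τ → ∀ j → frequency σ j ≈ frequency τ j
  frequency-↭ σ↭τ j = sum-↭ (map⁺ proj₂ (filter-↭ (λ u → proj₁ u Fin.≟ j) σ↭τ))

  frequency≈sum-point : ∀ σ j → frequency σ j ≈ sum (map (λ u → point u j) σ)
  frequency≈sum-point []      j = refl
  frequency≈sum-point (u ∷ σ) j = trans (frequency-∷ u σ j) (+-congˡ (frequency≈sum-point σ j))

  ∑-frequency : ∀ σ → ∑ (frequency σ) ≈ weightedLength σ
  ∑-frequency []            = sum-replicate-zero m
  ∑-frequency ((i , x) ∷ σ) = trans (sum-cong-≋ (frequency-∷ (i , x) σ))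
    (trans (∑-distrib-+ (point (i , x)) (frequency σ)) (+-cong (∑-point i x) (∑-frequency σ)))

-- Summaries as vectors over the whole universe, with k* = `suc n`.

module ReduceByMedianProperties
  {c ℓ₁ ℓ₂ : Level} (F : OrderedField c ℓ₁ ℓ₂) (m k n : ℕ) (n<k : n ℕ.< k) where

  open OrderedField F hiding (zero)
  open OrderedFieldProperties F
  open Streams F m
  open StreamProperties F m
  open ReduceByMedian F m k (suc n)
  open import Relation.Binary.Reasoning.PartialOrder poset

  NonNegative : Summary → Set ℓ₂
  NonNegative S = ∀ j → 0# ≤ estimate S j

  -- Absent items contribute zero, so sums over the counters in T become sums over all items, where
  -- they can be compared with frequencies. The general `φ` serves counter sums, frequencies and
  -- truncated counters alike.
  sum-map-entries : ∀ (φ : Item × Carrier → Carrier) S →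
                    sum (map φ (entries S)) ≈ ∑ (λ i → maybe′ (λ x → φ (i , x)) 0# (S i))
  sum-map-entries φ S = go id
    where
    -- The tail of `tabulate h` is `tabulate (h ∘ suc)`, so the induction needs an arbitrary `h` in
    -- place of the identity in `allFin`.
    go : ∀ {l} (h : Fin l → Item) →
         sum (map φ (mapMaybe (λ i → Maybe.map (i ,_) (S i)) (tabulate h))) ≈
         ∑ (λ a → maybe′ (λ x → φ (h a , x)) 0# (S (h a)))
    go {zero}  h = refl
    go {suc l} h with S (h zero)
    ... | just x  = +-congˡ (go (h ∘ suc))
    ... | nothing = trans (go (h ∘ suc)) (sym (+-identityˡ _))

  counterSum≈∑-estimate : ∀ S → counterSum S ≈ ∑ (estimate S)
  counterSum≈∑-estimate = sum-map-entries proj₂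

  -- No item is listed twice in `entries S`. Hence merging in a summary amounts to processing a
  -- stream whose frequency vector is the vector of its estimates.
  frequency-entries : ∀ S j → frequency (entries S) j ≈ estimate S j
  frequency-entries S j = trans (frequency≈sum-point (entries S) j)
    (trans (sum-map-entries (λ u → point u j) S)
    (trans (sum-cong-≋ point-estimate) (∑-point-diagonal (estimate S) j)))
    where
    point-estimate : ∀ i → maybe′ (λ x → point (i , x) j) 0# (S i) ≈ point (i , estimate S i) j
    point-estimate i with S i
    ... | just x = refl
    ... | nothing with i Fin.≟ j
    ...   | yes _ = refl
    ...   | no  _ = refl

  entries-nonNegative : ∀ S → NonNegative S → All (λ u → 0# ≤ proj₂ u) (entries S)
  entries-nonNegative S 0≤S = All.mapMaybe⁺ (All.map⁺ (All.universal entry (allFin m)))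
    where
    entry : ∀ i → Maybe.All (λ u → 0# ≤ proj₂ u) (Maybe.map (i ,_) (S i))
    entry i with S i | 0≤S i
    ... | just x  | 0≤x = Maybe.just 0≤x
    ... | nothing | _   = Maybe.nothing

  -- The threshold and the effect of a decrement.

  counters-nonNegative : ∀ S → NonNegative S → All (0# ≤_) (sortDescending (counters S))
  counters-nonNegative S 0≤S =
    All-resp-↭ (↭-sym (sortDescending-↭ (counters S))) (All.map⁺ (entries-nonNegative S 0≤S))

  n<∣counters∣ : ∀ S → k ℕ.≤ size S → n ℕ.< length (sortDescending (counters S))
  n<∣counters∣ S k≤∣S∣ = ℕ.≤-trans n<k (≡.subst (k ℕ.≤_)
    (≡.sym (≡.trans (↭-length (sortDescending-↭ (counters S))) (length-map proj₂ (entries S)))) k≤∣S∣)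

  threshold-nonNegative : ∀ S → NonNegative S → k ℕ.≤ size S → 0# ≤ threshold S
  threshold-nonNegative S 0≤S k≤∣S∣ = nth-All n (counters-nonNegative S 0≤S) (n<∣counters∣ S k≤∣S∣)

  -- The right side is the total loss in one decrement, by `decrement-balance`. Each of the k*
  -- largest counters contributes the full threshold to it.
  k*·threshold≤∑-⊓ : ∀ S → NonNegative S → k ℕ.≤ size S →
                     suc n · threshold S ≤ ∑ (λ j → estimate S j ⊓ threshold S)
  k*·threshold≤∑-⊓ S 0≤S k≤∣S∣ = begin
    suc n · d
      ≤⟨ [1+n]·nth≤sum-⊓ n (sortDescending-AllPairs (counters S))
           (counters-nonNegative S 0≤S) (n<∣counters∣ S k≤∣S∣) ⟩
    sum (map (_⊓ d) (sortDescending (counters S)))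
      ≈⟨ sum-↭ (map⁺ (_⊓ d) (sortDescending-↭ (counters S))) ⟩
    sum (map (_⊓ d) (counters S))
      ≡⟨ ≡.cong sum (≡.sym (map-∘ (entries S))) ⟩
    sum (map (λ u → proj₂ u ⊓ d) (entries S))
      ≈⟨ sum-map-entries (λ u → proj₂ u ⊓ d) S ⟩
    ∑ (λ i → maybe′ (_⊓ d) 0# (S i))
      ≈⟨ sum-cong-≋ estimate-⊓ ⟩
    ∑ (λ j → estimate S j ⊓ d) ∎
    where
    d = threshold S
    estimate-⊓ : ∀ i → maybe′ (_⊓ d) 0# (S i) ≈ estimate S i ⊓ d
    estimate-⊓ i with S i
    ... | just x  = refl
    -- An absent item has estimate zero, and truncation leaves zero fixed because the threshold is
    -- nonnegative.
    ... | nothing = sym (x≤y⇒x⊓y≈x (threshold-nonNegative S 0≤S k≤∣S∣))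

  -- A surviving counter loses exactly the threshold, a removed one loses its whole value, which is
  -- at most the threshold. Either loss is the minimum of the two.
  decrement-balance : ∀ S → 0# ≤ threshold S → ∀ j →
                      estimate (decrementCounters S) j + estimate S j ⊓ threshold S ≈ estimate S j
  decrement-balance S 0≤d j with S j
  ... | nothing = trans (+-identityˡ _) (x≤y⇒x⊓y≈x 0≤d)
  ... | just x with x - threshold S ≤? 0#
  ...   | yes x-d≤0 = trans (+-identityˡ _) (x≤y⇒x⊓y≈x (x-y≤0⇒x≤y x-d≤0))
  ...   | no  x-d≰0 = trans (+-congˡ (x≤y⇒y⊓x≈x (0≤y-x⇒x≤y (≰⇒≥ x-d≰0)))) ([x-y]+y≈x x _)

  decrement-nonNegative : ∀ S → NonNegative (decrementCounters S)
  decrement-nonNegative S j with S j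
  ... | nothing = ≤-refl
  ... | just x with x - threshold S ≤? 0#
  ...   | yes _     = ≤-refl
  ...   | no  x-d≰0 = ≰⇒≥ x-d≰0

  decrement-nothing : ∀ S {i} → S i ≡ nothing → estimate (decrementCounters S) i ≡ 0#
  decrement-nothing S Si≡nothing rewrite Si≡nothing = ≡.refl

  -- The increment `w` is given by an equation, so that the same lemma covers raising an existing
  -- counter and creating a new one.
  estimate-set : ∀ S i {v w} → estimate S i + w ≈ v →
                 ∀ j → estimate (set S i v) j ≈ estimate S j + point (i , w) j
  estimate-set S i {v} eq j with i Fin.≟ j
  ... | yes ≡.refl rewrite updateAt-updates i {λ _ → just v} S = sym eq
  ... | no i≢j rewrite updateAt-minimal j i {λ _ → just v} S (i≢j ∘ ≡.sym) = sym (+-identityʳ _)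

  set-nonNegative : ∀ S i {v} → NonNegative S → 0# ≤ v → NonNegative (set S i v)
  set-nonNegative S i {v} 0≤S 0≤v j with i Fin.≟ j
  ... | yes ≡.refl rewrite updateAt-updates i {λ _ → just v} S = 0≤v
  ... | no i≢j rewrite updateAt-minimal j i {λ _ → just v} S (i≢j ∘ ≡.sym) = 0≤S j

  -- An error vector together with a witness D, called `bound`. In the instances built below, D is
  -- the sum of the thresholds of all decrements performed.
  record Charged (e : Item → Carrier) : Set (c ⊔ ℓ₂) where
    field
      bound       : Carrier
      nonNegative : ∀ j → 0# ≤ e j
      bounded     : ∀ j → e j ≤ bound
      charge      : suc n · bound ≤ ∑ e

  open Charged

  charged-0 : Charged (λ _ → 0#)
  charged-0 = record
    { bound       = 0#
    ; nonNegative = λ _ → ≤-refl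
    ; bounded     = λ _ → ≤-refl
    ; charge      = ≤-reflexive (trans (n·0≈0 (suc n)) (sym (sum-replicate-zero m)))
    }
    where
    n·0≈0 : ∀ l → l · 0# ≈ 0#
    n·0≈0 zero    = refl
    n·0≈0 (suc l) = trans (+-identityˡ _) (n·0≈0 l)

  -- Every condition is linear in the error and the bound jointly, so errors from different phases
  -- can be added together with their bounds.
  charged-+ : ∀ {e e′} → Charged e → Charged e′ → Charged (λ j → e j + e′ j)
  charged-+ {e} {e′} p q = record
    { bound       = bound p + bound q
    ; nonNegative = λ j → +-nonNegative (nonNegative p j) (nonNegative q j)
    ; bounded     = λ j → +-mono-≤ (bounded p j) (bounded q j)
    ; charge      = begin
        suc n · (bound p + bound q)       ≈⟨ ×-distrib-+ (bound p) (bound q) (suc n) ⟩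
        suc n · bound p + suc n · bound q ≤⟨ +-mono-≤ (charge p) (charge q) ⟩
        ∑ e + ∑ e′                        ≈⟨ ∑-distrib-+ e e′ ⟨
        ∑ (λ j → e j + e′ j)              ∎
    }

  -- Here `w` is the part of the incoming weight that is lost. Item `i` has no counter to lose, so
  -- its own error is just `w` and stays within the threshold. The old counters already pay the
  -- charge, and `w` only adds to the total.
  charged-decrement : ∀ S → NonNegative S → k ℕ.≤ size S →
                      ∀ i {w} → S i ≡ nothing → 0# ≤ w → w ≤ threshold S →
                      Charged (λ j → estimate S j ⊓ threshold S + point (i , w) j)
  charged-decrement S 0≤S k≤∣S∣ i {w} Si≡nothing 0≤w w≤d = record
    { bound       = d
    ; nonNegative = λ j → +-nonNegative (⊓-glb (0≤S j) 0≤d) (point-nonNegative i j 0≤w)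
    ; bounded     = e≤d
    ; charge      = ≤-trans (k*·threshold≤∑-⊓ S 0≤S k≤∣S∣)
                      (∑-mono-≤ (λ j → x≤x+y _ (point-nonNegative i j 0≤w)))
    }
    where
    d   = threshold S
    0≤d = threshold-nonNegative S 0≤S k≤∣S∣
    e≤d : ∀ j → estimate S j ⊓ d + point (i , w) j ≤ d
    e≤d j with i Fin.≟ j
    ... | no _ = ≤-trans (≤-reflexive (+-identityʳ _)) (x⊓y≤y (estimate S j) d)
    ... | yes ≡.refl = begin
      estimate S i ⊓ d + w ≤⟨ +-monoˡ-≤ w (x⊓y≤x (estimate S i) d) ⟩
      estimate S i + w     ≡⟨ ≡.cong (λ s → fromMaybe 0# s + w) Si≡nothing ⟩
      0# + w               ≈⟨ +-identityˡ w ⟩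
      w                    ≤⟨ w≤d ⟩
      d                    ∎

  -- Weight `f` goes in at `S`, and what does not show up in `S′` is the error. The starting summary
  -- is arbitrary because the merge phase starts from `run σ₁`; nonnegativity is carried along so
  -- that transitions can be chained.
  record Transition (S : Summary) (f : Item → Carrier) (S′ : Summary) : Set (c ⊔ ℓ₁ ⊔ ℓ₂) where
    field
      error        : Item → Carrier
      charged      : Charged error
      balance      : ∀ j → estimate S′ j + error j ≈ estimate S j + f j
      nonNegative′ : NonNegative S′

  open Transition

  transition-set : ∀ S i {v w} → NonNegative S → 0# ≤ v → estimate S i + w ≈ v →
                   Transition S (point (i , w)) (set S i v)
  transition-set S i 0≤S 0≤v eq = record
    { error        = λ _ → 0#
    ; charged      = charged-0
    ; balance      = λ j → trans (+-identityʳ _) (estimate-set S i eq j)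
    ; nonNegative′ = set-nonNegative S i 0≤S 0≤v
    }

  transition-update : ∀ S i {Δ} → NonNegative S → 0# ≤ Δ →
                      Transition S (point (i , Δ)) (update S (i , Δ))
  transition-update S i {Δ} 0≤S 0≤Δ with S i in eq | size S ℕ.<? k | threshold S ≤? Δ
  ... | just x  | _ | _ = transition-set S i 0≤S
    (≤-trans (+-nonNegative (0≤S i) 0≤Δ) (≤-reflexive Si+Δ≈x+Δ)) Si+Δ≈x+Δ
    where
    Si+Δ≈x+Δ : estimate S i + Δ ≈ x + Δ
    Si+Δ≈x+Δ = reflexive (≡.cong (λ s → fromMaybe 0# s + Δ) eq)
  ... | nothing | yes _ | _ = transition-set S i 0≤S 0≤Δ
    (trans (reflexive (≡.cong (λ s → fromMaybe 0# s + Δ) eq)) (+-identityˡ Δ))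
  ... | nothing | no ∣S∣≮k | yes d≤Δ = record
    -- The new item enters with `Δ - d`, so `d` of its weight is lost.
    { error        = λ j → estimate S j ⊓ d + point (i , d) j
    ; charged      = charged-decrement S 0≤S k≤∣S∣ i eq 0≤d ≤-refl
    ; balance      = λ j → begin-equality
        estimate (set S₀ i (Δ - d)) j + (estimate S j ⊓ d + point (i , d) j)
          ≈⟨ +-congʳ (estimate-set S₀ i S₀i+Δ-d≈Δ-d j) ⟩
        (estimate S₀ j + point (i , Δ - d) j) + (estimate S j ⊓ d + point (i , d) j)
          -- Decremented counters are paired with their losses, and the retained part of `Δ` with
          -- the discarded part.
          ≈⟨ interchange _ _ _ _ ⟩
        (estimate S₀ j + estimate S j ⊓ d) + (point (i , Δ - d) j + point (i , d) j)
          ≈⟨ +-cong (decrement-balance S 0≤d j)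
               (trans (point-+ i (Δ - d) d j) (point-cong i j ([x-y]+y≈x Δ d))) ⟩
        estimate S j + point (i , Δ) j ∎
    ; nonNegative′ = set-nonNegative S₀ i (decrement-nonNegative S) (x≤y⇒0≤y-x d≤Δ)
    }
    where
    d     = threshold S
    S₀    = decrementCounters S
    k≤∣S∣ = ℕ.≮⇒≥ ∣S∣≮k
    0≤d   = threshold-nonNegative S 0≤S k≤∣S∣
    S₀i+Δ-d≈Δ-d : estimate S₀ i + (Δ - d) ≈ Δ - d
    S₀i+Δ-d≈Δ-d = trans (+-congʳ (reflexive (decrement-nothing S eq))) (+-identityˡ (Δ - d))
  ... | nothing | no ∣S∣≮k | no d≰Δ = record
    -- The new item is not stored: all of `Δ` is lost, and it is at most the threshold.
    { error        = λ j → estimate S j ⊓ threshold S + point (i , Δ) j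
    ; charged      = charged-decrement S 0≤S k≤∣S∣ i eq 0≤Δ (≰⇒≥ d≰Δ)
    ; balance      = λ j → trans (sym (+-assoc _ _ _))
                       (+-congʳ (decrement-balance S (threshold-nonNegative S 0≤S k≤∣S∣) j))
    ; nonNegative′ = decrement-nonNegative S
    }
    where k≤∣S∣ = ℕ.≮⇒≥ ∣S∣≮k

  -- Errors of successive updates add up. The weights are assumed nonnegative rather than positive
  -- because this is also applied to the entries of a summary, and an item inserted with `Δ` equal
  -- to the threshold gets counter zero.
  transition-updates : ∀ S σ → NonNegative S → All (λ u → 0# ≤ proj₂ u) σ →
                       Transition S (frequency σ) (foldl update S σ)
  transition-updates S []            0≤S []           = record
    { error        = λ _ → 0#
    ; charged      = charged-0
    ; balance      = λ _ → refl
    ; nonNegative′ = 0≤S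
    }
  transition-updates S ((i , Δ) ∷ σ) 0≤S (0≤Δ ∷ 0≤σ) = record
    { error        = λ j → error p j + error q j
    ; charged      = charged-+ (charged p) (charged q)
    ; balance      = λ j → begin-equality
        estimate S″ j + (error p j + error q j)
          ≈⟨ +-congˡ (+-comm (error p j) (error q j)) ⟩
        estimate S″ j + (error q j + error p j)
          ≈⟨ +-assoc _ _ _ ⟨
        (estimate S″ j + error q j) + error p j
          ≈⟨ +-congʳ (balance q j) ⟩
        (estimate S′ j + frequency σ j) + error p j
          ≈⟨ xy∙z≈xz∙y _ _ _ ⟩
        (estimate S′ j + error p j) + frequency σ j
          ≈⟨ +-congʳ (balance p j) ⟩
        (estimate S j + point (i , Δ) j) + frequency σ j
          ≈⟨ +-assoc _ _ _ ⟩
        estimate S j + (point (i , Δ) j + frequency σ j)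
          ≈⟨ +-congˡ (frequency-∷ (i , Δ) σ j) ⟨
        estimate S j + frequency ((i , Δ) ∷ σ) j ∎
    ; nonNegative′ = nonNegative′ q
    }
    where
    S′ = update S (i , Δ)
    S″ = foldl update S′ σ
    p  = transition-update S i 0≤S 0≤Δ
    q  = transition-updates S′ σ (nonNegative′ p) 0≤σ

  transition-merge : ∀ {σ₁ σ₂ es} →
                     All (λ u → 0# < proj₂ u) σ₁ → All (λ u → 0# < proj₂ u) σ₂ →
                     es ↭ entries (run σ₂) →
                     Transition empty (frequency (σ₁ ++ σ₂)) (merge (run σ₁) es)
  transition-merge {σ₁} {σ₂} {es} 0<σ₁ 0<σ₂ es↭ = record
    { error        = λ j → (error r j + error p j) + error q j
    ; charged      = charged-+ (charged-+ (charged r) (charged p)) (charged q)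
    ; balance      = λ j → begin-equality
        estimate S j + ((error r j + error p j) + error q j)
          ≈⟨ trans (+-congˡ (+-assoc _ _ _)) (sym (+-assoc _ _ _)) ⟩
        (estimate S j + error r j) + (error p j + error q j)
          ≈⟨ +-congʳ (balance r j) ⟩
        (estimate (run σ₁) j + frequency es j) + (error p j + error q j)
          ≈⟨ interchange _ _ _ _ ⟩
        (estimate (run σ₁) j + error p j) + (frequency es j + error q j)
          -- The processing order disappears here: the balance sees only the frequencies of `es`,
          -- which are the estimates of `run σ₂`.
          ≈⟨ +-congˡ (+-congʳ (trans (frequency-↭ es↭ j) (frequency-entries (run σ₂) j))) ⟩
        (estimate (run σ₁) j + error p j) + (estimate (run σ₂) j + error q j)
          ≈⟨ +-cong (balance p j) (balance q j) ⟩
        -- The zeros are the estimates of `empty`, from which both runs start.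
        (0# + frequency σ₁ j) + (0# + frequency σ₂ j)
          ≈⟨ trans (+-assoc _ _ _) (+-congˡ (+-congˡ (+-identityˡ _))) ⟩
        0# + (frequency σ₁ j + frequency σ₂ j)
          ≈⟨ +-congˡ (frequency-++ σ₁ σ₂ j) ⟨
        0# + frequency (σ₁ ++ σ₂) j ∎
    ; nonNegative′ = nonNegative′ r
    }
    where
    S = merge (run σ₁) es
    p = transition-updates empty σ₁ (λ _ → ≤-refl) (All.map proj₁ 0<σ₁)
    q = transition-updates empty σ₂ (λ _ → ≤-refl) (All.map proj₁ 0<σ₂)
    r = transition-updates (run σ₁) es (nonNegative′ p)
          (All-resp-↭ (↭-sym es↭) (entries-nonNegative (run σ₂) (nonNegative′ q)))

  -- Both error bounds from the final balance.

  module Bounds {σ S} (t : Transition empty (frequency σ) S) where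

    frequency≈estimate+error : ∀ j → frequency σ j ≈ estimate S j + error t j
    frequency≈estimate+error j = sym (trans (balance t j) (+-identityˡ _))

    frequency-estimate≈error : ∀ j → frequency σ j - estimate S j ≈ error t j
    frequency-estimate≈error j = x≈y+z⇒x-y≈z (frequency≈estimate+error j)

    lower : ∀ i → 0# ≤ frequency σ i - estimate S i
    lower i = ≤-trans (nonNegative (charged t) i) (≤-reflexive (sym (frequency-estimate≈error i)))

    private
      D = bound (charged t)

      upper : ∀ i l {x} → suc l · D ≤ x → frequency σ i - estimate S i ≤ x / fromℕ (suc l)
      upper i l {x} l·D≤x = begin
        frequency σ i - estimate S i ≈⟨ frequency-estimate≈error i ⟩
        error t i                    ≤⟨ bounded (charged t) i ⟩
        D                            ≤⟨ n·x≤y⇒x≤y/n l l·D≤x ⟩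
        x / fromℕ (suc l)            ∎

    ∑-error : ∑ (error t) ≈ weightedLength σ - counterSum S
    ∑-error = sym (x≈y+z⇒x-y≈z (begin-equality
      weightedLength σ                     ≈⟨ ∑-frequency σ ⟨
      ∑ (frequency σ)                      ≈⟨ sum-cong-≋ frequency≈estimate+error ⟩
      ∑ (λ j → estimate S j + error t j)   ≈⟨ ∑-distrib-+ (estimate S) (error t) ⟩
      ∑ (estimate S) + ∑ (error t)         ≈⟨ +-congʳ (counterSum≈∑-estimate S) ⟨
      counterSum S + ∑ (error t)           ∎))

    upper-counterSum : ∀ i → frequency σ i - estimate S i ≤
                             (weightedLength σ - counterSum S) / fromℕ (suc n)
    upper-counterSum i = upper i n (≤-trans (charge (charged t)) (≤-reflexive ∑-error))

    -- Truncating the frequencies at D lets each of the `j` most frequent items count for at most D,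
    -- while the others count for at most their frequency. Sorting does not change the truncated
    -- sum.
    k*·D≤j·D+residual : 0# ≤ D → ∀ j → suc n · D ≤ j · D + residual σ j
    k*·D≤j·D+residual 0≤D j = begin
      suc n · D
        ≤⟨ charge (charged t) ⟩
      ∑ (error t)
        ≤⟨ ∑-mono-≤ (λ i → ⊓-glb (error≤frequency i) (bounded (charged t) i)) ⟩
      ∑ (λ i → f i ⊓ D)
        ≈⟨ sum-tabulate (λ i → f i ⊓ D) ⟨
      sum (tabulate (λ i → f i ⊓ D))
        ≡⟨ ≡.cong sum (≡.sym (map-tabulate f (_⊓ D))) ⟩
      sum (map (_⊓ D) (tabulate f))
        ≈⟨ sum-↭ (map⁺ (_⊓ D) (sortDescending-↭ (tabulate f))) ⟨
      sum (map (_⊓ D) (sortDescending (tabulate f)))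
        ≤⟨ sum-⊓≤j·d+sum-drop 0≤D j (sortDescending (tabulate f)) ⟩
      j · D + residual σ j ∎
      where
      f = frequency σ
      error≤frequency : ∀ i → error t i ≤ f i
      error≤frequency i = ≤-trans (x≤y+x (error t i) (nonNegative′ t i))
                                  (≤-reflexive (sym (frequency≈estimate+error i)))

    upper-residual : ∀ i j → j ℕ.< suc n → frequency σ i - estimate S i ≤
                                           residual σ j / fromℕ (suc n ℕ.∸ j)
    -- The rewrite turns the divisor `suc n ∸ j` into `suc (n ∸ j)`, the successor form that `upper`
    -- expects.
    upper-residual i j (s≤s j≤n) rewrite ℕ.+-∸-assoc 1 j≤n =
      -- Splitting off `j` of the `suc n` copies of D and cancelling them leaves k* - j copies below
      -- the residual.
      upper i (n ℕ.∸ j) (+-cancelˡ-≤ (j · D) (begin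
        j · D + suc (n ℕ.∸ j) · D   ≈⟨ ×-homo-+ D j (suc (n ℕ.∸ j)) ⟨
        (j ℕ.+ suc (n ℕ.∸ j)) · D   ≡⟨ ≡.cong (_· D) j+1+[n-j]≡1+n ⟩
        suc n · D                   ≤⟨ k*·D≤j·D+residual 0≤D j ⟩
        j · D + residual σ j        ∎))
      where
      0≤D : 0# ≤ D
      -- `Charged` does not record the sign of D; the error of the given item `i` lies between zero
      -- and D.
      0≤D = ≤-trans (nonNegative (charged t) i) (bounded (charged t) i)
      j+1+[n-j]≡1+n : j ℕ.+ suc (n ℕ.∸ j) ≡ suc n
      j+1+[n-j]≡1+n = ≡.trans (ℕ.+-suc j (n ℕ.∸ j)) (≡.cong suc (ℕ.m+[n∸m]≡n j≤n))

theorem9 :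
  ∀ {c ℓ₁ ℓ₂ : Level} (F : OrderedField c ℓ₁ ℓ₂) (m k k* : ℕ) →
  let open OrderedField F
      open Streams F m
      open ReduceByMedian F m k k*
  in
  1 ℕ.≤ k → 1 ℕ.≤ k* → k* ℕ.≤ k →
  (σ₁ σ₂ : Stream) →
  All (λ u → 0# < proj₂ u) σ₁ → All (λ u → 0# < proj₂ u) σ₂ →
  (es : List (Item × Carrier)) → es ↭ entries (run σ₂) →
  let S = merge (run σ₁) es
      σ = σ₁ ++ σ₂
      N = weightedLength σ₁ + weightedLength σ₂
      C = counterSum S
      f = frequency σ
      f̂ = estimate S
  in
  (i : Item) →
    (0# ≤ f i - f̂ i × f i - f̂ i ≤ (N - C) / fromℕ k*)
    ×
    ((j : ℕ) → j ℕ.< k* →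
      0# ≤ f i - f̂ i × f i - f̂ i ≤ residual σ j / fromℕ (k* ℕ.∸ j))
-- The case k* = 0 is excluded by `1≤k*`.
theorem9 F m k (suc n) 1≤k 1≤k* k*≤k σ₁ σ₂ 0<σ₁ 0<σ₂ es es↭ i =
  (lower i , ≤-trans (upper-counterSum i) (≤-reflexive (*-congʳ (+-congʳ length-++)))) ,
  (λ j j<k* → lower i , upper-residual i j j<k*)
  where
  open OrderedField F
  open OrderedFieldProperties F
  open Streams F m
  -- With k* = `suc n`, the hypothesis `k*≤k` is by definition `n ℕ.< k`.
  open ReduceByMedianProperties F m k n k*≤k
  open Bounds {σ = σ₁ ++ σ₂} (transition-merge 0<σ₁ 0<σ₂ es↭)
  length-++ : weightedLength (σ₁ ++ σ₂) ≈ weightedLength σ₁ + weightedLength σ₂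
  length-++ = trans (reflexive (≡.cong sum (map-++ proj₂ σ₁ σ₂)))
                    (sum-++ (map proj₂ σ₁) (map proj₂ σ₂))
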